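{- Let $H$ be a finite simple graph whose edges are colored red and blue. Let $P$ be a maximum packing in $\mathcal F(H)$, let $uvx\in P$ be a triangle (with vertices $u,v,x$) whose red edge is $uv$, and let $uvy\in\mathcal F_P$. If $xy$ is a red edge of $H$ with $xy\notin R(P)$, then $uv$ is private in $\mathcal F_P$.
   Context: Graphs are finite and simple, and a triangle is identified with its set of three edges. For a family of triangles, a packing is a set of pairwise edge-disjoint members of the family; a maximum packing is one of largest size. For a graph $H$ whose edges are each colored red or blue, $\mathcal F(H)$ denotes the family of all triangles of $H$ with exactly one red edge (and hence two blue edges). For a packing $P$ in $\mathcal F(H)$, $R(P)$ and $B(P)$ denote the sets of red and blue edges, respectively, of the members of $P$. $H-X$ denotes $H$ with the edge set $X$ deleted (keeping the coloring of the remaining edges), and $\mathcal F_P=\mathcal F(H-B(P))$. An edge is private in a family of triangles if exactly one member of the family contains it. -}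

module Defs where

open import Data.Bool.Properties using () renaming (_≟_ to _≟ᵇ_)
open import Data.Fin using (Fin)
open import Data.Fin.Subset using (Subset; ⁅_⁆; _∪_; ∣_∣)
open import Data.List using (List; []; _∷_; length; filter; concat)
open import Data.List.Membership.Propositional using (_∈_)
open import Data.List.Membership.Propositional.Properties using (∈-filter⁻)
open import Data.List.Relation.Binary.Disjoint.Propositional using (Disjoint)
open import Data.List.Relation.Binary.Permutation.Propositional using (_↭_)
open import Data.List.Relation.Unary.All using (All)
open import Data.List.Relation.Unary.AllPairs using (AllPairs)
open import Data.List.Relation.Unary.Any using (Any)
open import Data.Nat using (ℕ; _≤_)
open import Data.Product using (_×_; ∃!; ∃-syntax; proj₁)
open import Data.Vec.Properties using (≡-dec)
open import Level using (0ℓ)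
open import Relation.Binary.Definitions using (DecidableEquality)
open import Relation.Binary.PropositionalEquality using (_≡_; refl)
open import Relation.Nullary using (yes; no; ¬?)
open import Relation.Unary using (Pred)

import Data.List.Membership.DecPropositional as DecMembership

private
  variable
    n : ℕ

data Colour : Set where
  red blue : Colour

_≟ᶜ_ : DecidableEquality Colour
red  ≟ᶜ red  = yes refl
red  ≟ᶜ blue = no λ ()
blue ≟ᶜ red  = no λ ()
blue ≟ᶜ blue = yes refl

-- An edge is a two-element set of vertices.  The size is imposed by the
-- graph; in particular edge u u is a singleton, hence never an edge of a graph.
Edge : ℕ → Set
Edge n = Subset n

edge : Fin n → Fin n → Edge n
edge u v = ⁅ u ⁆ ∪ ⁅ v ⁆

_≟ᵉ_ : DecidableEquality (Edge n)
_≟ᵉ_ = ≡-dec _≟ᵇ_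

-- Finite edge sets are lists, of which only membership matters.
EdgeSet : ℕ → Set
EdgeSet n = List (Edge n)

-- Only the values of colour on the members of edges are ever used.
record ColouredGraph (n : ℕ) : Set where
  field
    edges       : EdgeSet n
    two-element : ∀ {e} → e ∈ edges → ∣ e ∣ ≡ 2
    colour      : Edge n → Colour

open ColouredGraph public

_─_ : ColouredGraph n → EdgeSet n → ColouredGraph n
H ─ X = record
  { edges       = filter (λ e → ¬? (e ∈? X)) (edges H)
  ; two-element = λ e∈ → two-element H (proj₁ (∈-filter⁻ (λ e → ¬? (e ∈? X)) {xs = edges H} e∈))
  ; colour      = colour H
  }
  where open DecMembership _≟ᵉ_ using (_∈?_)

-- A triangle is its set of three edges.  These are distinct, so
-- triangles are the same exactly when their lists are permutations (_↭_).
triangle : Fin n → Fin n → Fin n → EdgeSet n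
triangle u v w = edge u v ∷ edge v w ∷ edge u w ∷ []

IsTriangle : ColouredGraph n → EdgeSet n → Set
IsTriangle H T = ∃[ u ] ∃[ v ] ∃[ w ] (T ↭ triangle u v w) × All (_∈ edges H) T

Family : ℕ → Set₁
Family n = Pred (EdgeSet n) 0ℓ

𝓕 : ColouredGraph n → Family n
𝓕 H T = IsTriangle H T × length (filter (λ e → colour H e ≟ᶜ red) T) ≡ 1

_∈ₜ_ : EdgeSet n → List (EdgeSet n) → Set
T ∈ₜ P = Any (T ↭_) P

-- Triangles are nonempty, so pairwise disjointness excludes repetitions and
-- the length of the list is the number of triangles in the packing.
IsPacking : Family n → List (EdgeSet n) → Set
IsPacking F P = All F P × AllPairs Disjoint P

IsMaximumPacking : Family n → List (EdgeSet n) → Set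
IsMaximumPacking F P = IsPacking F P × (∀ Q → IsPacking F Q → length Q ≤ length P)

R B : ColouredGraph n → List (EdgeSet n) → EdgeSet n
R H P = filter (λ e → colour H e ≟ᶜ red)  (concat P)
B H P = filter (λ e → colour H e ≟ᶜ blue) (concat P)

𝓕[_,_] : ColouredGraph n → List (EdgeSet n) → Family n
𝓕[ H , P ] = 𝓕 (H ─ B H P)

Private : Family n → Edge n → Set
Private F e = ∃! _↭_ (λ T → F T × e ∈ T)

{-# OPTIONS --safe #-}
-- If uvz ≠ uvy is a second triangle of 𝓕[ H , P ] on uv, then x, y, u, v, z are
-- distinct, so xyu (with red edge xy) and uvz are edge-disjoint members of 𝓕 H.
-- Their edges other than uv and ux are not used by P, so exchanging uvx for
-- these two triangles enlarges P.
module Submission where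

open import Defs
open import Data.Fin using (Fin; _≟_)
open import Data.Fin.Subset using (⁅_⁆; ∣_∣) renaming (_∈_ to _∈ˢ_; _∉_ to _∉ˢ_)
open import Data.Fin.Subset.Properties
  using (x∈⁅x⁆; x∈⁅y⁆⇒x≡y; ∣⁅x⁆∣≡1; ∪-idem; ∪-comm; x∈p∪q⁻; x∈p∪q⁺)
open import Data.List using (List; []; _∷_; _++_; length; filter; concat)
open import Data.List.Membership.Propositional using (_∈_; _∉_; find)
open import Data.List.Membership.Propositional.Properties
  using (∈-filter⁻; ∈-filter⁺; ∈-concat⁺′; ∈-∃++; ∈-++⁺ˡ; ∈-++⁺ʳ)
open import Data.List.Relation.Binary.Disjoint.Propositional using (Disjoint)
open import Data.List.Relation.Binary.Permutation.Propositional
  using (_↭_; ↭-refl; ↭-sym; ↭-trans; prep; swap; ↭⇒↭ₛ)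
open import Data.List.Relation.Binary.Permutation.Propositional.Properties
  using (All-resp-↭; ∈-resp-↭; ↭-length; filter-↭; shift)
open import Data.List.Relation.Unary.All as All using (All; []; _∷_)
open import Data.List.Relation.Unary.AllPairs using (_∷_)
open import Data.List.Relation.Unary.Any using (here; there)
open import Data.Nat using (ℕ)
open import Data.Nat.Properties using (1+n≰n; ≤-trans; ≤-reflexive)
open import Data.Product using (_×_; _,_; proj₁; proj₂; ∃-syntax)
open import Data.Sum using (_⊎_; inj₁; inj₂; [_,_]′)
open import Function using (_∘_)
open import Relation.Binary.PropositionalEquality
  using (_≡_; _≢_; refl; sym; trans; cong; subst; resp₂; setoid)
open import Relation.Nullary using (¬_; yes; no; ¬?; contradiction)

import Data.List.Membership.DecPropositional as DecMembership
import Data.List.Relation.Binary.Permutation.Setoid.Properties as Permutationₛ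

private
  variable
    n : ℕ

edge-comm : ∀ (u v : Fin n) → edge u v ≡ edge v u
edge-comm u v = ∪-comm ⁅ u ⁆ ⁅ v ⁆

∈-edge⁻ : ∀ {w} (u v : Fin n) → w ∈ˢ edge u v → w ≡ u ⊎ w ≡ v
∈-edge⁻ u v w∈ with x∈p∪q⁻ ⁅ u ⁆ ⁅ v ⁆ w∈
... | inj₁ w∈u = inj₁ (x∈⁅y⁆⇒x≡y u w∈u)
... | inj₂ w∈v = inj₂ (x∈⁅y⁆⇒x≡y v w∈v)

∈-edgeˡ : ∀ (u v : Fin n) → u ∈ˢ edge u v
∈-edgeˡ u v = x∈p∪q⁺ (inj₁ (x∈⁅x⁆ u))

∈-edgeʳ : ∀ (u v : Fin n) → v ∈ˢ edge u v
∈-edgeʳ u v = x∈p∪q⁺ (inj₂ (x∈⁅x⁆ v))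

∉-edge : ∀ {w u v : Fin n} → w ≢ u → w ≢ v → w ∉ˢ edge u v
∉-edge w≢u w≢v = [ w≢u , w≢v ]′ ∘ ∈-edge⁻ _ _

edge-injective : ∀ {u v a b : Fin n} → u ≢ v → edge u v ≡ edge a b →
                 (u ≡ a × v ≡ b) ⊎ (u ≡ b × v ≡ a)
edge-injective {u = u} {v} {a} {b} u≢v eq
  with ∈-edge⁻ a b (subst (u ∈ˢ_) eq (∈-edgeˡ u v))
     | ∈-edge⁻ a b (subst (v ∈ˢ_) eq (∈-edgeʳ u v))
... | inj₁ u≡a | inj₁ v≡a = contradiction (trans u≡a (sym v≡a)) u≢v
... | inj₁ u≡a | inj₂ v≡b = inj₁ (u≡a , v≡b)
... | inj₂ u≡b | inj₁ v≡a = inj₂ (u≡b , v≡a)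
... | inj₂ u≡b | inj₂ v≡b = contradiction (trans u≡b (sym v≡b)) u≢v

-- If the endpoints coincided, idempotence of union would turn the edge into a singleton, of size 1
-- rather than 2.
edge⇒≢ : ∀ (H : ColouredGraph n) {u v} → edge u v ∈ edges H → u ≢ v
edge⇒≢ H {u} uv∈ refl
  with () ← trans (sym (two-element H uv∈)) (trans (cong ∣_∣ (∪-idem ⁅ u ⁆)) (∣⁅x⁆∣≡1 u))

triangle-swap : ∀ (a b c : Fin n) → triangle a b c ↭ triangle b a c
triangle-swap a b c rewrite edge-comm b a = prep _ (swap _ _ ↭-refl)

triangle-rotate : ∀ (a b c : Fin n) → triangle a b c ↭ triangle b c a
triangle-rotate a b c rewrite edge-comm c a | edge-comm b a =
  ↭-trans (swap _ _ ↭-refl) (prep _ (swap _ _ ↭-refl))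

-- Normalizes an arbitrary triangle on uv, so that its third vertex can be compared with y. By
-- `edge-injective`, uv is one of three edges in one of two orientations; each of the six cases is
-- settled by composing swaps and rotations.
triangle-through : ∀ {u v : Fin n} a b c → u ≢ v → edge u v ∈ triangle a b c →
                   ∃[ w ] triangle a b c ↭ triangle u v w
triangle-through a b c u≢v (here uv≡ab) with edge-injective u≢v uv≡ab
... | inj₁ (refl , refl) = c , ↭-refl
... | inj₂ (refl , refl) = c , triangle-swap a b c
triangle-through a b c u≢v (there (here uv≡bc)) with edge-injective u≢v uv≡bc
... | inj₁ (refl , refl) = a , triangle-rotate a b c
... | inj₂ (refl , refl) = a , ↭-trans (triangle-rotate a b c) (triangle-swap b c a)
triangle-through a b c u≢v (there (there (here uv≡ac))) with edge-injective u≢v uv≡ac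
... | inj₁ (refl , refl) = b , ↭-trans (triangle-swap a b c) (triangle-rotate b a c)
... | inj₂ (refl , refl) = b , ↭-trans (triangle-rotate a b c) (triangle-rotate b c a)

𝓕-resp-↭ : ∀ (H : ColouredGraph n) {T T′} → T ↭ T′ → 𝓕 H T → 𝓕 H T′
𝓕-resp-↭ H T↭T′ ((u , v , w , T↭uvw , T⊆H) , oneRed) =
  (u , v , w , ↭-trans (↭-sym T↭T′) T↭uvw , All-resp-↭ T↭T′ T⊆H) ,
  trans (sym (↭-length (filter-↭ (λ e → colour H e ≟ᶜ red) T↭T′))) oneRed

∈-─⁻ : ∀ (H : ColouredGraph n) X {e} → e ∈ edges (H ─ X) → e ∈ edges H × e ∉ X
∈-─⁻ H X = ∈-filter⁻ (λ e → ¬? (e ∈? X)) {xs = edges H}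
  where open DecMembership _≟ᵉ_ using (_∈?_)

𝓕-─ : ∀ (H : ColouredGraph n) X {T} → 𝓕 (H ─ X) T → 𝓕 H T
𝓕-─ H X ((u , v , w , T↭uvw , T⊆H─X) , oneRed) =
  (u , v , w , T↭uvw , All.map (proj₁ ∘ ∈-─⁻ H X) T⊆H─X) , oneRed

𝓕-colours : ∀ (H : ColouredGraph n) {e f g} → colour H e ≡ red → 𝓕 H (e ∷ f ∷ g ∷ []) →
            colour H f ≡ blue × colour H g ≡ blue
𝓕-colours H {e} {f} {g} e-red (_ , oneRed)
  -- Generalizing `oneRed` together with the colours lets its count reduce: a second red edge would
  -- make it at least 2.
  rewrite e-red with colour H f | oneRed
... | red  | ()
... | blue | oneRed′ with colour H g | oneRed′
...   | blue | _ = refl , refl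

𝓕-triangle : ∀ (H : ColouredGraph n) u v w → All (_∈ edges H) (triangle u v w) →
             colour H (edge u v) ≡ red → colour H (edge v w) ≡ blue →
             colour H (edge u w) ≡ blue → 𝓕 H (triangle u v w)
𝓕-triangle H u v w uvw⊆H uv-red vw-blue uw-blue = (u , v , w , ↭-refl , uvw⊆H) , oneRed
  where
  oneRed : length (filter (λ e → colour H e ≟ᶜ red) (triangle u v w)) ≡ 1
  oneRed rewrite uv-red | vw-blue | uw-blue = refl

blue-∉-packing : ∀ (H : ColouredGraph n) P {e} → e ∈ edges (H ─ B H P) →
                 colour H e ≡ blue → e ∉ concat P
blue-∉-packing H P e∈ e-blue e∈P =
  proj₂ (∈-─⁻ H (B H P) e∈) (∈-filter⁺ (λ e → colour H e ≟ᶜ blue) e∈P e-blue)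

-- Replacing `T` by `T₁` and `T₂` would give a packing with one more member. Edges of `T` may be
-- reused because no other member of `P` contains them.
no-exchange : ∀ {F : Family n} {P T T₁ T₂} → IsMaximumPacking F P → T ∈ P →
              F T₁ → F T₂ → Disjoint T₁ T₂ →
              ¬ All (λ e → e ∈ T ⊎ e ∉ concat P) (T₁ ++ T₂)
no-exchange {n} {F} {P} {T} {T₁} {T₂} ((P⊆F , P-disj) , P-max) T∈P FT₁ FT₂ T₁#T₂ free
  with ps , qs , refl ← ∈-∃++ T∈P
  with _ ∷ P′⊆F ← All-resp-↭ (shift T ps qs) P⊆F
  -- Moving `T` to the front preserves pairwise disjointness, since `Disjoint` is symmetric.
  with T#P′ ∷ P′-disj ← Permutationₛ.AllPairs-resp-↭ (setoid (EdgeSet n)) {R = Disjoint}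
         (λ S#S′ (∈S′ , ∈S) → S#S′ (∈S , ∈S′)) (resp₂ Disjoint) (↭⇒↭ₛ (shift T ps qs)) P-disj
  -- The new packing has two members besides `ps ++ qs`, while `P` has only one.
  = 1+n≰n (≤-trans
      (P-max (T₁ ∷ T₂ ∷ ps ++ qs)
        ( FT₁ ∷ FT₂ ∷ P′⊆F
        , (T₁#T₂ ∷ All.tabulate (λ S∈ (e∈T₁ , e∈S) → fresh (∈-++⁺ˡ e∈T₁) S∈ e∈S))
          ∷ All.tabulate (λ S∈ (e∈T₂ , e∈S) → fresh (∈-++⁺ʳ T₁ e∈T₂) S∈ e∈S)
          ∷ P′-disj))
      (≤-reflexive (↭-length (shift T ps qs))))
  where
  fresh : ∀ {e S} → e ∈ T₁ ++ T₂ → S ∈ ps ++ qs → e ∉ S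
  fresh e∈ S∈ e∈S with All.lookup free e∈
  ... | inj₁ e∈T = All.lookup T#P′ S∈ (e∈T , e∈S)
  ... | inj₂ e∉P = e∉P (∈-concat⁺′ e∈S (∈-resp-↭ (↭-sym (shift T ps qs)) (there S∈)))

lemma2p1 : ∀ {n : ℕ} (H : ColouredGraph n) (P : List (EdgeSet n)) →
    IsMaximumPacking (𝓕 H) P →
    ∀ (u v x y : Fin n) →
    triangle u v x ∈ₜ P →
    colour H (edge u v) ≡ red →
    𝓕[ H , P ] (triangle u v y) →
    edge x y ∈ edges H →
    colour H (edge x y) ≡ red →
    edge x y ∉ R H P →
    Private 𝓕[ H , P ] (edge u v)
lemma2p1 {n} H P P-max u v x y uvx∈ₜP uv-red uvy∈𝓕ₚ@((_ , _ , _ , _ , uv∈ₚ ∷ vy∈ₚ ∷ uy∈ₚ ∷ []) , _)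
         xy∈ xy-red xy∉R
  -- Membership `∈ₜ` is up to permutation; `T` is the list that actually occurs in `P`.
  with T , T∈P , uvx↭T ← find uvx∈ₜP
  with uvx∈𝓕@((_ , _ , _ , _ , _ ∷ vx∈ ∷ ux∈ ∷ []) , _) ←
         𝓕-resp-↭ H (↭-sym uvx↭T) (All.lookup (proj₁ (proj₁ P-max)) T∈P)
  = triangle u v y , (uvy∈𝓕ₚ , here refl) , unique
  where
  H′ = H ─ B H P

  ux-blue = proj₂ (𝓕-colours H uv-red uvx∈𝓕)

  -- Deleting edges keeps the colouring, so a colour found in `H′` is one in `H`.
  uy-blue = proj₂ (𝓕-colours H′ uv-red uvy∈𝓕ₚ)

  uy∈ = proj₁ (∈-─⁻ H (B H P) uy∈ₚ)

  u≢v = edge⇒≢ H′ uv∈ₚ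

  -- This triangle lies in `𝓕 H` but not in `𝓕[ H , P ]`: its blue edge ux belongs to `B H P`.
  -- Maximality of `P` is over `𝓕 H`, so that is enough.
  xyu∈𝓕 : 𝓕 H (triangle x y u)
  xyu∈𝓕 = 𝓕-triangle H x y u
    (xy∈ ∷ subst (_∈ edges H) (edge-comm u y) uy∈ ∷ subst (_∈ edges H) (edge-comm u x) ux∈ ∷ [])
    xy-red (subst (λ e → colour H e ≡ blue) (edge-comm u y) uy-blue)
    (subst (λ e → colour H e ≡ blue) (edge-comm u x) ux-blue)

  Free : Edge n → Set
  Free e = e ∈ T ⊎ e ∉ concat P

  no-third : ∀ z → 𝓕[ H , P ] (triangle u v z) → ¬ y ≢ z
  no-third z uvz∈𝓕ₚ@((_ , _ , _ , _ , _ ∷ vz∈ₚ ∷ uz∈ₚ ∷ []) , _) y≢z =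
    no-exchange P-max T∈P xyu∈𝓕 (𝓕-─ H (B H P) uvz∈𝓕ₚ) xyu#uvz free
    where
    vz-blue = proj₁ (𝓕-colours H′ uv-red uvz∈𝓕ₚ)
    uz-blue = proj₂ (𝓕-colours H′ uv-red uvz∈𝓕ₚ)

    vz∉P = blue-∉-packing H P vz∈ₚ vz-blue

    -- The edge vx is used by `P`, whereas vz is not.
    x≢z : x ≢ z
    x≢z refl = vz∉P (∈-concat⁺′ (∈-resp-↭ uvx↭T (there (here refl))) T∈P)

    x∉ : All (x ∉ˢ_) (triangle u v z)
    x∉ = ∉-edge x≢u x≢v ∷ ∉-edge x≢v x≢z ∷ ∉-edge x≢u x≢z ∷ []
      where
      x≢u = edge⇒≢ H ux∈ ∘ sym
      x≢v = edge⇒≢ H vx∈ ∘ sym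

    y∉ : All (y ∉ˢ_) (triangle u v z)
    y∉ = ∉-edge y≢u y≢v ∷ ∉-edge y≢v y≢z ∷ ∉-edge y≢u y≢z ∷ []
      where
      y≢u = edge⇒≢ H uy∈ ∘ sym
      y≢v = edge⇒≢ H′ vy∈ₚ ∘ sym

    -- Every edge of xyu contains x or y, and no edge of uvz contains either.
    xyu#uvz : Disjoint (triangle x y u) (triangle u v z)
    xyu#uvz (here refl , e∈)                 = All.lookup x∉ e∈ (∈-edgeˡ x y)
    xyu#uvz (there (here refl) , e∈)         = All.lookup y∉ e∈ (∈-edgeˡ y u)
    xyu#uvz (there (there (here refl)) , e∈) = All.lookup x∉ e∈ (∈-edgeˡ x u)

    free : All Free (triangle x y u ++ triangle u v z)
    free =
      inj₂ (λ xy∈P → xy∉R (∈-filter⁺ (λ e → colour H e ≟ᶜ red) xy∈P xy-red)) ∷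
      inj₂ (subst (_∉ concat P) (edge-comm u y) (blue-∉-packing H P uy∈ₚ uy-blue)) ∷
      inj₁ (∈-resp-↭ uvx↭T (there (there (here (edge-comm x u))))) ∷
      inj₁ (∈-resp-↭ uvx↭T (here refl)) ∷
      inj₂ vz∉P ∷
      inj₂ (blue-∉-packing H P uz∈ₚ uz-blue) ∷ []

  unique : ∀ {S} → 𝓕[ H , P ] S × edge u v ∈ S → triangle u v y ↭ S
  unique (S∈𝓕ₚ@((a , b , c , S↭abc , _) , _) , uv∈S)
    with z , abc↭uvz ← triangle-through a b c u≢v (∈-resp-↭ S↭abc uv∈S)
    with S↭uvz ← ↭-trans S↭abc abc↭uvz
    -- Once the triangle is written as uvz, its third vertex determines it, so only y ≠ z has to be
    -- excluded.
    with y ≟ z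
  ... | yes refl = ↭-sym S↭uvz
  ... | no y≢z   = contradiction y≢z (no-third z (𝓕-resp-↭ H′ S↭uvz S∈𝓕ₚ))
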